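{- Let $k\ge 1$, let $G$ be a $k$-tree, and let $\mathcal{A}$ be the antimatroid whose basic words are the elimination orderings of $G$. Then the set of basic words of $\mathcal{A}$ contains a double ladder, and $\mathcal{A}$ is balanced.
   Context: A $k$-tree is a graph obtained from a complete graph on $k+1$ vertices by adding zero or more vertices one at a time, each new vertex being made adjacent exactly to the vertices of some existing $k$-vertex clique. An elimination ordering of a graph is a total ordering of its vertices such that for each vertex $v$, the neighbors of $v$ occurring later than $v$ form a clique. The elimination orderings of a chordal graph are the basic words of an antimatroid $\mathcal{A}$ on the vertex set (an antimatroid is a union-closed accessible family of sets; a basic word is a permutation of its elements whose every prefix set lies in the family). For vertices $x\ne y$, $\Pr[x<y]$ is the probability $x$ precedes $y$ in a uniformly random basic word; a balanced pair has $\frac13\le\Pr[x<y]\le\frac23$; $\mathcal{A}$ is balanced if it has a balanced pair or exactly one basic word. For a set $\Omega$ of orderings, an element $x$ and a nonempty sequence $Y=(y_0,\dots,y_{k'-1})$ of distinct elements, $(x,Y)$ is a ladder if: (1) in every ordering of $\Omega$, the elements of $Y$ occurring earlier than $x$ occur in the order of $Y$; (2) whenever $w\in\Omega$ has some elements of $Y$ earlier than $x$ and $i$ is the largest index with $y_i$ earlier than $x$ in $w$, swapping $x$ and $y_i$ in $w$ yields an ordering in $\Omega$. A double ladder is a pair of nonempty sequences $X=(x_0,\dots)$, $Y=(y_0,\dots)$ with $(x_0,Y)$ and $(y_0,X)$ both ladders. -}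

module Defs where

open import Data.Nat using (ℕ; zero; suc; _+_; _*_; _≤_)
open import Data.Bool using (Bool; true; false; if_then_else_; T; _∧_; _∨_)
open import Data.Fin using (Fin; punchIn; _<_)
open import Data.Fin.Properties using (_≟_)
open import Data.List using (List; []; _∷_; length; allFin; map; lookup)
open import Data.Bool.ListAction using (any)
open import Data.List.Membership.Propositional using (_∈_; _∉_)
open import Data.List.Relation.Unary.Unique.Propositional using (Unique)
open import Data.List.Relation.Binary.Permutation.Propositional using (_↭_)
open import Data.Product using (Σ; ∃; ∃-syntax; _×_; _,_)
open import Data.Sum using (_⊎_)
open import Relation.Nullary using (¬_; ⌊_⌋)
open import Relation.Binary.PropositionalEquality using (_≡_; _≢_)

record Graph (n : ℕ) : Set where
  field
    adj   : Fin n → Fin n → Bool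
    sym   : ∀ i j → adj i j ≡ adj j i
    irref : ∀ i → adj i i ≡ false
open Graph public

Adj : ∀ {n} → Graph n → Fin n → Fin n → Set
Adj G i j = T (adj G i j)

countB : ∀ {A : Set} → (A → Bool) → List A → ℕ
countB p []       = 0
countB p (x ∷ xs) = if p x then suc (countB p xs) else countB p xs

delete : ∀ {n} → Fin (suc n) → Graph (suc n) → Graph n
delete v G = record
  { adj   = λ i j → adj G (punchIn v i) (punchIn v j)
  ; sym   = λ i j → sym G (punchIn v i) (punchIn v j)
  ; irref = λ i → irref G (punchIn v i) }

data IsKTree (k : ℕ) : {n : ℕ} → Graph n → Set where
  base : (G : Graph (suc k)) →
         (∀ i j → i ≢ j → Adj G i j) →
         IsKTree k G
  step : ∀ {n} (G : Graph (suc n)) (v : Fin (suc n)) →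
         IsKTree k (delete v G) →
         countB (λ i → adj G v (punchIn v i)) (allFin n) ≡ k →
         (∀ i j → Adj G v (punchIn v i) → Adj G v (punchIn v j) → i ≢ j →
                  Adj G (punchIn v i) (punchIn v j)) →
         IsKTree k G

memB : ∀ {n} → Fin n → List (Fin n) → Bool
memB x = any (λ z → ⌊ z ≟ x ⌋)

before : ∀ {n} → Fin n → Fin n → List (Fin n) → Bool
before x y []      = false
before x y (z ∷ w) =
  if ⌊ z ≟ x ⌋ then memB y w
  else (if ⌊ z ≟ y ⌋ then false else before x y w)

Before : ∀ {n} → Fin n → Fin n → List (Fin n) → Set
Before x y w = T (before x y w)

IsElimOrdering : ∀ {n} → Graph n → List (Fin n) → Set
IsElimOrdering {n} G w =
  (w ↭ allFin n) ×
  (∀ v a b → Before v a w → Before v b w → a ≢ b →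
     Adj G v a → Adj G v b → Adj G a b)

swapF : ∀ {n} → Fin n → Fin n → Fin n → Fin n
swapF a b z = if ⌊ z ≟ a ⌋ then b else (if ⌊ z ≟ b ⌋ then a else z)

swapList : ∀ {n} → Fin n → Fin n → List (Fin n) → List (Fin n)
swapList a b = map (swapF a b)

Ladder : ∀ {n} → List (List (Fin n)) → Fin n → List (Fin n) → Set
Ladder Ω x Y =
  (Y ≢ []) × Unique Y × (x ∉ Y) ×
  (∀ w → w ∈ Ω → ∀ (i j : Fin (length Y)) → i < j →
     Before (lookup Y i) x w → Before (lookup Y j) x w →
     Before (lookup Y i) (lookup Y j) w) ×
  (∀ w → w ∈ Ω → ∀ (i : Fin (length Y)) →
     Before (lookup Y i) x w →
     (∀ (j : Fin (length Y)) → i < j → ¬ Before (lookup Y j) x w) →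
     swapList x (lookup Y i) w ∈ Ω)

DoubleLadder : ∀ {n} → List (List (Fin n)) → Set
DoubleLadder {n} Ω =
  Σ (List (Fin n)) λ X → Σ (List (Fin n)) λ Y →
  Σ (Fin n) λ x₀ → Σ (List (Fin n)) λ X' →
  Σ (Fin n) λ y₀ → Σ (List (Fin n)) λ Y' →
    (X ≡ x₀ ∷ X') × (Y ≡ y₀ ∷ Y') × Ladder Ω x₀ Y × Ladder Ω y₀ X

-- Balance.  For Ω the (duplicate-free) list of basic words,
-- Pr[x<y] = countB (before x y) Ω / length Ω, and 1/3 ≤ Pr ≤ 2/3 is
-- written multiplied out.

BalancedPair : ∀ {n} → List (List (Fin n)) → Fin n → Fin n → Set
BalancedPair Ω x y =
  x ≢ y ×
  (length Ω ≤ 3 * countB (before x y) Ω) ×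
  (3 * countB (before x y) Ω ≤ 2 * length Ω)

Balanced : ∀ {n} → List (List (Fin n)) → Set
Balanced {n} Ω = (∃[ x ] ∃[ y ] BalancedPair Ω x y) ⊎ (length Ω ≡ 1)

{-# OPTIONS --safe #-}
module Submission where

-- Take any two nonadjacent simplicial vertices x, y. Deleting other simplicial vertices as long as
-- there are any leaves a k-tree S ⊇ {x , y} whose only simplicial vertices are x and y. If S − y is
-- not complete, it has again exactly two simplicial vertices, x and a neighbour y₁ of y; iterating
-- yields y = y₀, y₁, y₂, … and S = S₀, S₁ = S₀ − y₀, …, down to a (k+1)-clique. In an elimination
-- ordering the first vertex of each Sᵢ is simplicial in Sᵢ, so it is yᵢ or x: the yᵢ before x form a
-- prefix of the sequence, in order. When yᵢ is removed, its remaining neighbours lie in Sᵢ because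
-- G has no (k+2)-clique; hence no vertex strictly between the last such yᵢ and x is adjacent to yᵢ
-- (at the final step x and yᵢ are twins instead), and x and yᵢ may be exchanged.
--
-- Balance: this exchange injects the words with exactly i + 1 of the y's before x into those with
-- exactly i, so the numbers eᵢ of such words decrease. By symmetry of the pair, assume
-- Pr[y₀ < x] > 2/3. Then all steps Pr[yᵢ < x] − Pr[yᵢ₊₁ < x] are below 1/3, and the
-- probabilities Pr[yᵢ < x], descending to 0, cannot jump over [1/3 , 2/3].

open import Defs
open import Data.Nat using (ℕ; zero; suc; _≤_; _<_; _+_; _*_; z≤n; s≤s; s≤s⁻¹)
open import Data.Nat.Properties using (≤-refl; ≤-reflexive; ≤-trans; <-irrefl; <-≤-trans; ≤-<-trans; <⇒≤; ≰⇒>; _≤?_; m≤n⇒m≤1+n; m≤m+n; suc-injective; +-suc; +-comm; +-identityʳ; +-monoʳ-≤; +-monoˡ-<; +-monoʳ-<; +-cancelˡ-<; +-cancelʳ-<; *-distribˡ-+; *-monoʳ-≤; module ≤-Reasoning)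
open import Data.Bool using (Bool; true; false; T; not; _∧_)
open import Data.Bool.Properties using (T?; T-∧)
open import Data.Fin as Fin using (Fin; zero; suc; punchIn; punchOut)
open import Data.Fin.Properties using (_≟_; punchIn-injective; punchInᵢ≢i; punchIn-punchOut)
open import Data.List using (List; []; _∷_; length; map; filterᵇ; allFin; lookup)
open import Data.List.Properties using (length-map; length-tabulate; map-∘; map-cong; map-id; map-injective)
open import Data.List.Membership.Propositional using (_∈_; _∉_; find; lose)
open import Data.List.Membership.DecPropositional using (_∈?_)
open import Data.List.Membership.Propositional.Properties using (∈-map⁺; ∈-map⁻; ∈-filter⁺; ∈-filter⁻; ∈-allFin; ∈-lookup)
open import Data.List.Relation.Binary.Subset.Propositional using (_⊆_)
open import Data.List.Relation.Binary.Subset.Propositional.Properties as Subset using (∈-∷⁺ʳ; ⊆∷∧∉⇒⊆)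
open import Data.List.Membership.Propositional.Properties.WithK using (unique∧set⇒bag)
open import Data.List.Relation.Binary.BagAndSetEquality using (∼bag⇒↭)
open import Data.List.Relation.Binary.Permutation.Propositional using (↭-sym; ↭⇒↭ₛ)
open import Data.List.Relation.Binary.Permutation.Propositional.Properties using (∈-resp-↭)
open import Data.List.Relation.Binary.Permutation.Setoid.Properties using (Unique-resp-↭)
open import Data.List.Relation.Unary.All as All using ([]; _∷_)
open import Data.List.Relation.Unary.All.Properties using (¬Any⇒All¬)
open import Data.List.Relation.Unary.Any as Any using (here; there; any?)
open import Data.List.Relation.Unary.AllPairs using ([]; _∷_)
open import Data.List.Relation.Unary.Unique.Propositional using (Unique)
open import Data.List.Relation.Unary.Unique.Propositional.Properties as Unique using (Unique[x∷xs]⇒x∉xs)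
open import Data.Product using (Σ; ∃; ∃-syntax; _×_; _,_; proj₁; proj₂)
open import Data.Sum as Sum using (_⊎_; inj₁; inj₂)
open import Data.Empty using (⊥-elim)
open import Function using (_∘_)
open import Function.Bundles using (_⇔_; mk⇔; Equivalence)
open import Relation.Nullary using (¬_; Dec; yes; no; ¬?; _×-dec_; _→-dec_; contradiction)
open import Relation.Nullary.Decidable using (decidable-stable; map′)
open import Relation.Binary.PropositionalEquality using (_≡_; _≢_; refl; trans; cong; subst; subst₂; ≢-sym)
import Relation.Binary.PropositionalEquality as ≡

-- Duplicate-free lists as finite sets

∉⇒≢ : ∀ {A : Set} {v u : A} {R} → v ∉ R → u ∈ R → u ≢ v
∉⇒≢ v∉R u∈R refl = v∉R u∈R

∷-unique : ∀ {A : Set} {v : A} {R} → v ∉ R → Unique R → Unique (v ∷ R)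
∷-unique v∉R uR = ¬Any⇒All¬ _ v∉R ∷ uR

two-distinct : ∀ {A : Set} {R : List A} → Unique R → 2 ≤ length R →
               Σ A λ x → Σ A λ y → x ≢ y
two-distinct {R = x ∷ y ∷ _} ((x≢y ∷ _) ∷ _) _ = x , y , x≢y
two-distinct {R = _ ∷ []}    _                (s≤s ())

-- A relation rather than an operation: only membership and length matter, and the order of `R′` is
-- left open.
record Deletion {A : Set} (v : A) (R R′ : List A) : Set where
  field
    sub  : R′ ⊆ R
    gone : v ∉ R′
    keep : ∀ {u} → u ∈ R → u ≢ v → u ∈ R′
    len  : length R ≡ suc (length R′)
open Deletion

delete-head : ∀ {A : Set} {v : A} {R} → v ∉ R → Deletion v (v ∷ R) R
delete-head v∉R = record
  { sub  = there
  ; gone = v∉R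
  ; keep = λ u∈ u≢v → Any.tail u≢v u∈
  ; len  = refl }

delete-tail : ∀ {A : Set} {u v : A} {R R′} → v ≢ u → Deletion v R R′ → Deletion v (u ∷ R) (u ∷ R′)
delete-tail v≢u d = record
  { sub  = ∈-∷⁺ʳ (here refl) (there ∘ sub d)
  ; gone = λ { (here v≡u) → v≢u v≡u ; (there v∈R′) → gone d v∈R′ }
  ; keep = λ { (here a≡u) _ → here a≡u ; (there a∈R) a≢v → there (keep d a∈R a≢v) }
  ; len  = cong suc (len d) }

delete-∈ : ∀ {A : Set} {v : A} {R} → Unique R → v ∈ R → ∃[ R′ ] Unique R′ × Deletion v R R′
delete-∈ u@(_ ∷ uR) (here refl) = _ , uR , delete-head (Unique[x∷xs]⇒x∉xs u)
delete-∈ u@(_ ∷ uR) (there v∈R) with delete-∈ uR v∈R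
... | R′ , uR′ , d = _ , ∷-unique (Unique[x∷xs]⇒x∉xs u ∘ sub d) uR′ ,
                     delete-tail (∉⇒≢ (Unique[x∷xs]⇒x∉xs u) v∈R) d

⊆-length : ∀ {A : Set} {Q R : List A} → Unique Q → Unique R → Q ⊆ R → length Q ≤ length R
⊆-length []            uR Q⊆R = z≤n
⊆-length u@(_ ∷ uQ) uR Q⊆R with delete-∈ uR (Q⊆R (here refl))
... | R′ , uR′ , d = subst (_ ≤_) (≡.sym (len d))
  (s≤s (⊆-length uQ uR′ (λ q → keep d (Q⊆R (there q)) (∉⇒≢ (Unique[x∷xs]⇒x∉xs u) q))))

module _ {n : ℕ} where

  -- A missed element could be put in front of `Q`, giving a duplicate-free list inside `R` that is
  -- longer than `R`.
  ⊆-full : {Q R : List (Fin n)} → Unique Q → Unique R → Q ⊆ R → length R ≤ length Q → R ⊆ Q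
  ⊆-full {Q} uQ uR Q⊆R R≤Q {u} u∈R with _∈?_ _≟_ u Q
  ... | yes u∈Q = u∈Q
  ... | no  u∉Q = contradiction
    (≤-trans (⊆-length (∷-unique u∉Q uQ) uR (∈-∷⁺ʳ u∈R Q⊆R)) R≤Q) (<-irrefl refl)

  missing : {Q R : List (Fin n)} → Unique Q → Unique R → length Q < length R → ∃[ u ] u ∈ R × u ∉ Q
  missing {Q} {R} uQ uR Q<R with any? (λ u → ¬? (_∈?_ _≟_ u Q)) R
  ... | yes p = find p
  ... | no ¬p = contradiction (≤-trans Q<R (⊆-length uR uQ R⊆Q)) (<-irrefl refl)
    where
    R⊆Q : R ⊆ Q
    R⊆Q {u} u∈R = decidable-stable (_∈?_ _≟_ u Q) (λ u∉Q → ¬p (lose u∈R u∉Q))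

-- k-trees on vertex lists of a fixed graph, and their simplicial vertices

module _ {n : ℕ} (G : Graph n) where

  Clique : List (Fin n) → Set
  Clique R = ∀ {a b} → a ∈ R → b ∈ R → a ≢ b → Adj G a b

  Simplicial : List (Fin n) → Fin n → Set
  Simplicial R v = ∀ {a b} → a ∈ R → b ∈ R → a ≢ b → Adj G v a → Adj G v b → Adj G a b

  Adj-sym : ∀ {a b} → Adj G a b → Adj G b a
  Adj-sym {a} {b} = subst T (sym G a b)

  Adj⇒≢ : ∀ {a b} → Adj G a b → a ≢ b
  Adj⇒≢ {a} p refl = subst T (irref G a) p

  ∷-clique : ∀ {v R} → Clique R → (∀ {a} → a ∈ R → Adj G v a) → Clique (v ∷ R)
  ∷-clique c p (here refl) (here refl) a≢b = contradiction refl a≢b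
  ∷-clique c p (here refl) (there b)   _   = p b
  ∷-clique c p (there a)   (here refl) _   = Adj-sym (p a)
  ∷-clique c p (there a)   (there b)   a≢b = c a b a≢b

  simplicial? : ∀ R v → Dec (Simplicial R v)
  simplicial? R v = map′
    (λ f {a} {b} a∈R b∈R → All.lookup (All.lookup f a∈R) b∈R)
    (λ s → All.tabulate (λ a∈R → All.tabulate (λ b∈R → s a∈R b∈R)))
    (All.all? (λ a → All.all? (λ b → ¬? (a ≟ b) →-dec (T? _ →-dec (T? _ →-dec T? _))) R) R)

  simplicial-⊆ : ∀ {R S v} → S ⊆ R → Simplicial R v → Simplicial S v
  simplicial-⊆ S⊆R s a b = s (S⊆R a) (S⊆R b)

  simplicial-insert : ∀ {u v R R′} → (∀ {a} → a ∈ R → a ≢ u → a ∈ R′) → ¬ Adj G v u →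
                      Simplicial R′ v → Simplicial R v
  simplicial-insert keep v≁u s a b a≢b va vb =
    s (keep a (λ { refl → v≁u va })) (keep b (λ { refl → v≁u vb })) a≢b va vb

  -- Some `k` neighbours of `v`, possibly not all of them. Completeness is a separate premise of
  -- `KTree.step`; elsewhere it is derived from the absence of larger cliques.
  record Nbrs (k : ℕ) (v : Fin n) (R Q : List (Fin n)) : Set where
    field
      unique : Unique Q
      size   : length Q ≡ k
      within : Q ⊆ R
      adj-to : ∀ {u} → u ∈ Q → Adj G v u
  open Nbrs

  Nbrs-⊆ : ∀ {k v R S Q} → S ⊆ R → Nbrs k v S Q → Nbrs k v R Q
  Nbrs-⊆ S⊆R N = record
    { unique = unique N ; size = size N ; within = S⊆R ∘ within N ; adj-to = adj-to N }

  -- The list is a vertex set of one fixed graph, newest vertex first, so that deleting a vertex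
  -- renames nothing.
  data KTree (k : ℕ) : List (Fin n) → Set where
    base : ∀ {R} → Unique R → length R ≡ suc k → Clique R → KTree k R
    step : ∀ {v R Q} → v ∉ R → KTree k R → Nbrs k v R Q →
           (∀ {u} → u ∈ R → Adj G v u → u ∈ Q) → Clique Q → KTree k (v ∷ R)

  module _ {k : ℕ} where

    KTree-unique : ∀ {R} → KTree k R → Unique R
    KTree-unique (base uR _ _)        = uR
    KTree-unique (step v∉R t _ _ _) = ∷-unique v∉R (KTree-unique t)

    -- A clique through the newest vertex has its other members among the `k` neighbours of that
    -- vertex; any other clique lies in the smaller k-tree.
    clique-size : ∀ {R Q} → KTree k R → Unique Q → Q ⊆ R → Clique Q → length Q ≤ suc k
    clique-size (base uR l _) uQ Q⊆R _ = subst (_ ≤_) l (⊆-length uQ uR Q⊆R)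
    clique-size {Q = Q} (step {v} v∉R t N full _) uQ Q⊆R c with _∈?_ _≟_ v Q
    ... | no v∉Q = clique-size t uQ (λ q → keep (delete-head v∉R) (Q⊆R q) (∉⇒≢ v∉Q q)) c
    ... | yes v∈Q with delete-∈ uQ v∈Q
    ...   | Q′ , uQ′ , d = subst (_≤ suc k) (≡.sym (len d)) (s≤s (subst (length Q′ ≤_) (size N)
            (⊆-length uQ′ (unique N) (λ q →
              full (keep (delete-head v∉R) (Q⊆R (sub d q)) (∉⇒≢ (gone d) q))
                   (c v∈Q (sub d q) (≢-sym (∉⇒≢ (gone d) q)))))))

    -- Otherwise `v`, `u` and `Q` would form a clique on `k + 2` vertices.
    nbrs-complete : ∀ {R v u Q} → KTree k R → v ∈ R → Nbrs k v R Q → u ∈ R → Adj G v u →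
                    Clique (u ∷ Q) → u ∈ Q
    nbrs-complete {R} {v} {u} {Q} t v∈R N u∈R vu c with _∈?_ _≟_ u Q
    ... | yes u∈Q = u∈Q
    ... | no  u∉Q = contradiction
      (subst (λ l → suc (suc l) ≤ suc k) (size N)
        (clique-size t (∷-unique v∉ (∷-unique u∉Q (unique N)))
          (∈-∷⁺ʳ v∈R (∈-∷⁺ʳ u∈R (within N))) (∷-clique c v~)))
      (<-irrefl refl)
      where
      v~ : ∀ {a} → a ∈ u ∷ Q → Adj G v a
      v~ (here refl) = vu
      v~ (there q)   = adj-to N q
      v∉ : v ∉ u ∷ Q
      v∉ q = Adj⇒≢ (v~ q) refl

    simplicial-nbrs : ∀ {R v u Q} → KTree k R → v ∈ R → Simplicial R v → Nbrs k v R Q →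
                      u ∈ R → Adj G v u → u ∈ Q
    simplicial-nbrs {R} {v} {u} {Q} t v∈R s N u∈R vu = nbrs-complete t v∈R N u∈R vu
      (λ a b a≢b → s (in-R a) (in-R b) a≢b (v~ a) (v~ b))
      where
      in-R : u ∷ Q ⊆ R
      in-R = ∈-∷⁺ʳ u∈R (within N)
      v~ : ∀ {a} → a ∈ u ∷ Q → Adj G v a
      v~ (here refl) = vu
      v~ (there q)   = adj-to N q

    min-degree : ∀ {R v} → KTree k R → v ∈ R → ∃ (Nbrs k v R)
    min-degree (base uR l c) v∈R with delete-∈ uR v∈R
    ... | Q , uQ , d = Q , record
      { unique = uQ
      ; size   = suc-injective (trans (≡.sym (len d)) l)
      ; within = sub d
      ; adj-to = λ q → c v∈R (sub d q) (≢-sym (∉⇒≢ (gone d) q)) }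
    min-degree (step _ t N _ _) (here refl) = _ , Nbrs-⊆ there N
    min-degree (step _ t _ _ _) (there v∈R) with min-degree t v∈R
    ... | Q , N = Q , Nbrs-⊆ there N

    min-size : ∀ {R} → KTree k R → suc k ≤ length R
    min-size (base _ l _)       = ≤-reflexive (≡.sym l)
    min-size (step _ t _ _ _) = m≤n⇒m≤1+n (min-size t)

    non-nbr : ∀ {R v Q} → KTree k R → Nbrs k v R Q → ∃[ u ] u ∈ R × u ∉ Q
    non-nbr t N = missing (unique N) (KTree-unique t) (subst (_< _) (≡.sym (size N)) (min-size t))

    -- `R` has at least `k + 1` vertices and `v` is adjacent to only `k` of them.
    step-¬clique : ∀ {v R Q} → v ∉ R → KTree k R → Nbrs k v R Q →
                   (∀ {u} → u ∈ R → Adj G v u → u ∈ Q) → ¬ Clique (v ∷ R)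
    step-¬clique v∉R t N full c with non-nbr t N
    ... | u , u∈R , u∉Q = u∉Q (full u∈R (c (here refl) (there u∈R) (≢-sym (∉⇒≢ v∉R u∈R))))

    clique-or-not : ∀ {R} → KTree k R → (length R ≡ suc k × Clique R) ⊎ ¬ Clique R
    clique-or-not (base _ l c)              = inj₁ (l , c)
    clique-or-not (step v∉R t N full _) = inj₂ (step-¬clique v∉R t N full)

    -- Deleting `v` commutes with the later addition of a vertex `u`, because `u` is not adjacent to
    -- `v`.
    delete-simplicial : ∀ {R v} → KTree k R → ¬ Clique R → v ∈ R → Simplicial R v →
                        ∃[ R′ ] KTree k R′ × Deletion v R R′
    delete-simplicial (base _ _ c) ¬c _ _ = contradiction (λ {a} {b} → c {a} {b}) ¬c
    delete-simplicial (step u∉R t _ _ _) _ (here refl) _ = _ , t , delete-head u∉R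
    delete-simplicial {v = v} r@(step {u} {R} {Q} u∉R t N full c) _ (there v∈R) s =
      go (clique-or-not t)
      where
      v≢u : v ≢ u
      v≢u = ∉⇒≢ u∉R v∈R
      -- `v` has `k` neighbours in `R` already; being simplicial, it has no others.
      v≁u : ¬ Adj G v u
      v≁u vu = let P , M = min-degree t v∈R in
        u∉R (within M (simplicial-nbrs r (there v∈R) s (Nbrs-⊆ there M) (here refl) vu))
      go : (length R ≡ suc k × Clique R) ⊎ ¬ Clique R →
           ∃[ R′ ] KTree k R′ × Deletion v (u ∷ R) R′
      -- `R` is the initial clique. The `k` neighbours of `u` avoid `v`, so they are all the rest of
      -- `R`, and `u` takes the place of `v` in a new initial clique.
      go (inj₁ (l , cR)) with delete-∈ (KTree-unique t) v∈R
      ... | R′ , uR′ , d = _ ,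
        base (∷-unique (u∉R ∘ sub d) uR′) (trans (≡.sym (len d)) l)
          (∷-clique (λ a b → cR (sub d a) (sub d b)) (adj-to N ∘ R′⊆Q)) ,
        delete-tail v≢u d
        where
        R′⊆Q : R′ ⊆ Q
        R′⊆Q = ⊆-full (unique N) uR′
          (λ q → keep d (within N q) (λ { refl → v≁u (Adj-sym (adj-to N q)) }))
          (≤-reflexive (trans (suc-injective (trans (≡.sym (len d)) l)) (≡.sym (size N))))
      go (inj₂ ¬c) with delete-simplicial t ¬c v∈R (simplicial-⊆ there s)
      ... | R′ , t′ , d = _ ,
        step (u∉R ∘ sub d) t′
          (record { unique = unique N ; size = size N ; adj-to = adj-to N
                  ; within = λ q → keep d (within N q) (λ { refl → v≁u (Adj-sym (adj-to N q)) }) })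
          (full ∘ sub d) c ,
        delete-tail v≢u d

    -- After the deletion of `a`, the vertex `b` still has `k` neighbours. As `b` is simplicial in
    -- `R`, these are all its neighbours in `R`, and `a` is not one of them.
    simplicial-nonadjacent : ∀ {R a b} → KTree k R → ¬ Clique R → a ∈ R → b ∈ R →
                             Simplicial R a → Simplicial R b → ¬ Adj G a b
    simplicial-nonadjacent t ¬c a∈R b∈R sa sb ab with delete-simplicial t ¬c a∈R sa
    ... | R′ , t′ , d with min-degree t′ (keep d b∈R (≢-sym (Adj⇒≢ ab)))
    ...   | Q , N = gone d (within N
                      (simplicial-nbrs t b∈R sb (Nbrs-⊆ (sub d) N) a∈R (Adj-sym ab)))

    -- The newest vertex `v` is simplicial. If it is the one to avoid, a simplicial vertex of `R`
    -- not adjacent to `v` serves, since adding `v` leaves its neighbourhood unchanged.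
    another-simplicial : ∀ {R} → KTree k R → ¬ Clique R → ∀ x → ∃[ y ] y ∈ R × Simplicial R y × y ≢ x
    another-simplicial (base _ _ c) ¬c x = contradiction (λ {a} {b} → c {a} {b}) ¬c
    another-simplicial (step {v} {R} v∉R t N full c) _ x with v ≟ x
    ... | no v≢x = v , here refl ,
      simplicial-v , v≢x
      where
      simplicial-v : Simplicial (v ∷ R) v
      simplicial-v (here refl) _ _ vv _ = contradiction refl (Adj⇒≢ vv)
      simplicial-v (there _) (here refl) _ _ vv = contradiction refl (Adj⇒≢ vv)
      simplicial-v (there a) (there b) a≢b va vb = c (full a va) (full b vb) a≢b
    ... | yes refl = go (clique-or-not t)
      where
      extend : ∀ {y} → y ∈ R → Simplicial R y → ¬ Adj G y v →
               ∃[ y ] y ∈ v ∷ R × Simplicial (v ∷ R) y × y ≢ v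
      extend y∈R s y≁v = _ , there y∈R ,
        simplicial-insert (keep (delete-head v∉R)) y≁v s , ∉⇒≢ v∉R y∈R
      go : (length R ≡ suc k × Clique R) ⊎ ¬ Clique R →
           ∃[ y ] y ∈ v ∷ R × Simplicial (v ∷ R) y × y ≢ v
      go (inj₁ (l , cR)) with non-nbr t N
      ... | u , u∈R , u∉Q =
        extend u∈R (λ a b a≢b _ _ → cR a b a≢b) (λ uv → u∉Q (full u∈R (Adj-sym uv)))
      go (inj₂ ¬c) with another-simplicial t ¬c v
      ... | y , y∈R , sy , _ with another-simplicial t ¬c y | T? (adj G y v)
      ...   | _                      | no y≁v = extend y∈R sy y≁v
      -- If both `y` and `z` were adjacent to `v`, they would lie in the clique to which `v` was
      -- attached and be adjacent to each other.
      ...   | z , z∈R , sz , z≢y | yes yv = extend z∈R sz (λ zv →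
              simplicial-nonadjacent t ¬c z∈R y∈R sz sy
                (c (full z∈R (Adj-sym zv)) (full y∈R (Adj-sym yv)) z≢y))

    -- k-trees with exactly two simplicial vertices

    -- The (k+1)-cliques of S then form a path, whose end cliques contain x and y.
    record Ends (x y : Fin n) (S : List (Fin n)) : Set where
      field
        ktree : KTree k S
        x∈S   : x ∈ S
        y∈S   : y ∈ S
        x≢y   : x ≢ y
        x≁y   : ¬ Adj G x y
        sx    : Simplicial S x
        sy    : Simplicial S y
        only  : ∀ {z} → z ∈ S → Simplicial S z → z ≡ x ⊎ z ≡ y

    -- The bound `m` on the length drives the recursion. While nonadjacent `x` and `y` remain, the
    -- list is no clique, so any third simplicial vertex can be deleted.
    shrink-to-ends : ∀ {x y S} m → length S ≤ m → KTree k S → x ∈ S → y ∈ S → x ≢ y → ¬ Adj G x y →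
                     Simplicial S x → Simplicial S y → ∃ (Ends x y)
    shrink-to-ends {S = []} zero z≤n t () _ _ _ _ _
    shrink-to-ends {x} {y} {S} (suc m) l t x∈S y∈S x≢y x≁y sx sy
      with any? (λ z → simplicial? S z ×-dec ¬? (z ≟ x) ×-dec ¬? (z ≟ y)) S
    ... | no ¬p = S , record
      { ktree = t ; x∈S = x∈S ; y∈S = y∈S ; x≢y = x≢y ; x≁y = x≁y ; sx = sx ; sy = sy
      ; only = only }
      where
      only : ∀ {z} → z ∈ S → Simplicial S z → z ≡ x ⊎ z ≡ y
      only {z} z∈S s with z ≟ x | z ≟ y
      ... | yes z≡x | _       = inj₁ z≡x
      ... | no _    | yes z≡y = inj₂ z≡y
      ... | no z≢x  | no z≢y  = contradiction (lose z∈S ((λ {a} {b} → s {a} {b}) , z≢x , z≢y)) ¬p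
    ... | yes p with find p
    ...   | z , z∈S , sz , z≢x , z≢y
      with delete-simplicial t (λ c → x≁y (c x∈S y∈S x≢y)) z∈S sz
    ...     | S′ , t′ , d = shrink-to-ends m (s≤s⁻¹ (subst (_≤ suc m) (len d) l)) t′
              (keep d x∈S (≢-sym z≢x)) (keep d y∈S (≢-sym z≢y)) x≢y x≁y
              (simplicial-⊆ (sub d) sx) (simplicial-⊆ (sub d) sy)

    -- A simplicial vertex of `S′` other than `x` is adjacent to `y`, or it would be a third
    -- simplicial vertex of `S`. Two such vertices would be adjacent because `y` is simplicial, but
    -- simplicial vertices of `S′` are not.
    next-end : ∀ {x y S S′} → Ends x y S → KTree k S′ → ¬ Clique S′ → Deletion y S S′ →
               ∃[ y′ ] Ends x y′ S′
    next-end {x} {y} {S} {S′} E t ¬c d with another-simplicial t ¬c x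
    ... | y′ , y′∈S′ , sy′ , y′≢x = y′ , record
      { ktree = t ; x∈S = x∈S′ ; y∈S = y′∈S′ ; x≢y = ≢-sym y′≢x
      ; x≁y = simplicial-nonadjacent t ¬c x∈S′ y′∈S′ sx′ sy′ ; sx = sx′ ; sy = sy′ ; only = only′ }
      where
      open Ends E
      x∈S′ : x ∈ S′
      x∈S′ = keep d x∈S x≢y
      sx′ : Simplicial S′ x
      sx′ = simplicial-⊆ (sub d) sx
      y~ : ∀ {z} → z ∈ S′ → Simplicial S′ z → z ≢ x → Adj G y z
      y~ {z} z∈S′ s z≢x with T? (adj G z y)
      ... | yes zy = Adj-sym zy
      ... | no z≁y with only (sub d z∈S′) (simplicial-insert (keep d) z≁y s)
      ...   | inj₁ z≡x  = contradiction z≡x z≢x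
      ...   | inj₂ refl = contradiction z∈S′ (gone d)
      only′ : ∀ {z} → z ∈ S′ → Simplicial S′ z → z ≡ x ⊎ z ≡ y′
      only′ {z} z∈S′ s with z ≟ x | z ≟ y′
      ... | yes z≡x | _        = inj₁ z≡x
      ... | no _    | yes z≡y′ = inj₂ z≡y′
      ... | no z≢x  | no z≢y′  = contradiction
        (sy (sub d z∈S′) (sub d y′∈S′) z≢y′ (y~ z∈S′ s z≢x) (y~ y′∈S′ sy′ y′≢x))
        (simplicial-nonadjacent t ¬c z∈S′ y′∈S′ s sy′)

    -- `Q` is the clique `S′` without `x`. The `k` neighbours of `y` lie in `S′` and avoid `x`, so
    -- they exhaust `Q`.
    last-twins : ∀ {x y S S′} → Ends x y S → length S′ ≡ suc k → Clique S′ → Unique S′ →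
                 Deletion y S S′ → ∃[ Q ] Nbrs k x S Q ×
                 (∀ {u} → u ∈ S → u ≢ x → u ≢ y → u ∈ Q) × (∀ {u} → u ∈ Q → Adj G y u)
    last-twins {x} {y} {S} {S′} E l c uS′ d with delete-∈ uS′ (keep d (Ends.x∈S E) (Ends.x≢y E))
    ... | Q , uQ , e with min-degree (Ends.ktree E) (Ends.y∈S E)
    ...   | P , M = Q , record
      { unique = uQ ; size = lQ ; within = sub d ∘ sub e
      ; adj-to = λ q → c (keep d x∈S x≢y) (sub e q) (≢-sym (∉⇒≢ (gone e) q)) } ,
      (λ u∈S u≢x u≢y → keep e (keep d u∈S u≢y) u≢x) ,
      λ q → adj-to M (⊆-full (unique M) uQ P⊆Q (≤-reflexive (trans lQ (≡.sym (size M)))) q)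
      where
      open Ends E
      lQ : length Q ≡ k
      lQ = suc-injective (trans (≡.sym (len e)) l)
      P⊆Q : P ⊆ Q
      P⊆Q p = keep e (keep d (within M p) (≢-sym (Adj⇒≢ (adj-to M p))))
                (λ { refl → x≁y (Adj-sym (adj-to M p)) })

-- From the inductive definition of k-trees to vertex lists

module _ {n : ℕ} (G : Graph (suc n)) (v : Fin (suc n)) where

  private
    f : Fin n → Fin (suc n)
    f = punchIn v

    f-unique : ∀ {R} → Unique R → Unique (map f R)
    f-unique = Unique.map⁺ (punchIn-injective v _ _)

    f-∉ : ∀ {i R} → i ∉ R → f i ∉ map f R
    f-∉ i∉R fi∈ with ∈-map⁻ f fi∈
    ... | j , j∈R , eq = i∉R (subst (_∈ _) (≡.sym (punchIn-injective v _ _ eq)) j∈R)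

    f-clique : ∀ {R} → Clique (delete v G) R → Clique G (map f R)
    f-clique c a b a≢b with ∈-map⁻ f a | ∈-map⁻ f b
    ... | i , i∈R , refl | j , j∈R , refl = c i∈R j∈R (a≢b ∘ cong f)

  KTree-delete : ∀ {k R} → KTree (delete v G) k R → KTree G k (map f R)
  KTree-delete {R = R} (base uR l c) =
    base (f-unique uR) (trans (length-map f R) l) (f-clique (λ {a} {b} → c {a} {b}))
  KTree-delete (step {u} {R} {Q} u∉R t N full c) =
    step (f-∉ u∉R) (KTree-delete t)
      (record { unique = f-unique (Nbrs.unique N)
              ; size   = trans (length-map f Q) (Nbrs.size N)
              ; within = Subset.map⁺ f (Nbrs.within N)
              ; adj-to = adj-to })
      full′ (f-clique (λ {a} {b} → c {a} {b}))
    where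
    adj-to : ∀ {a} → a ∈ map f Q → Adj G (f u) a
    adj-to a∈ with ∈-map⁻ f a∈
    ... | i , i∈Q , refl = Nbrs.adj-to N i∈Q
    full′ : ∀ {a} → a ∈ map f R → Adj G (f u) a → a ∈ map f Q
    full′ a∈ p with ∈-map⁻ f a∈
    ... | i , i∈R , refl = ∈-map⁺ f (full i∈R p)

countB-filter : ∀ {A : Set} (p : A → Bool) xs → countB p xs ≡ length (filterᵇ p xs)
countB-filter p []       = refl
countB-filter p (x ∷ xs) with p x
... | true  = cong suc (countB-filter p xs)
... | false = countB-filter p xs

IsKTree⇒KTree : ∀ {k n} {G : Graph n} → IsKTree k G → ∃[ R ] KTree G k R × (∀ z → z ∈ R)
IsKTree⇒KTree {k} (base G c) = allFin (suc k) ,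
  base (Unique.allFin⁺ _) (length-tabulate (λ (i : Fin (suc k)) → i)) (λ _ _ → c _ _) , ∈-allFin
IsKTree⇒KTree {k} (step {n} G v t count c) with IsKTree⇒KTree t
... | R , r , all = v ∷ map f R ,
  step v∉ (KTree-delete G v r)
    (record { unique = Unique.map⁺ (punchIn-injective v _ _)
                         (Unique.filter⁺ (T? ∘ p) (Unique.allFin⁺ n))
            ; size   = trans (length-map f (filterᵇ p (allFin n)))
                         (trans (≡.sym (countB-filter p (allFin n))) count)
            ; within = Subset.map⁺ f (λ {i} _ → all i)
            ; adj-to = adj-to })
    full clique , all′
  where
  f : Fin n → Fin (suc n)
  f = punchIn v
  p : Fin n → Bool
  p i = adj G v (f i)
  v∉ : v ∉ map f R
  v∉ v∈ with ∈-map⁻ f v∈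
  ... | i , _ , eq = punchInᵢ≢i v i (≡.sym eq)
  adj-to : ∀ {a} → a ∈ map f (filterᵇ p (allFin n)) → Adj G v a
  adj-to a∈ with ∈-map⁻ f a∈
  ... | i , i∈ , refl = proj₂ (∈-filter⁻ (T? ∘ p) {xs = allFin n} i∈)
  full : ∀ {a} → a ∈ map f R → Adj G v a → a ∈ map f (filterᵇ p (allFin n))
  full a∈ va with ∈-map⁻ f a∈
  ... | i , i∈ , refl = ∈-map⁺ f (∈-filter⁺ (T? ∘ p) (∈-allFin i) va)
  clique : Clique G (map f (filterᵇ p (allFin n)))
  clique a∈ b∈ a≢b with ∈-map⁻ f a∈ | ∈-map⁻ f b∈
  ... | i , i∈ , refl | j , j∈ , refl = c i j (adj-to a∈) (adj-to b∈) (a≢b ∘ cong f)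
  all′ : ∀ z → z ∈ v ∷ map f R
  all′ z with v ≟ z
  ... | yes refl = here refl
  ... | no v≢z = there (subst (_∈ map f R) (punchIn-punchOut v≢z) (∈-map⁺ f (all (punchOut v≢z))))

-- Precedence in a list and exchange of two elements

module _ {n : ℕ} where

  -- The inductive counterpart of `Before`, made for pattern matching. In a list with repetitions it
  -- does not imply `Before`.
  data Precedes (a b : Fin n) : List (Fin n) → Set where
    here  : ∀ {w} → b ∈ w → Precedes a b (a ∷ w)
    there : ∀ {z w} → Precedes a b w → Precedes a b (z ∷ w)

  precedes-∈ˡ : ∀ {a b w} → Precedes a b w → a ∈ w
  precedes-∈ˡ (here _)  = here refl
  precedes-∈ˡ (there p) = there (precedes-∈ˡ p)

  precedes-∈ʳ : ∀ {a b w} → Precedes a b w → b ∈ w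
  precedes-∈ʳ (here b∈w) = there b∈w
  precedes-∈ʳ (there p)  = there (precedes-∈ʳ p)

  precedes-irrefl : ∀ {a b w} → Unique w → Precedes a b w → a ≢ b
  precedes-irrefl u       (here a∈w) refl = Unique[x∷xs]⇒x∉xs u a∈w
  precedes-irrefl (_ ∷ u) (there p)       = precedes-irrefl u p

  precedes-trans : ∀ {a b c w} → Unique w → Precedes a b w → Precedes b c w → Precedes a c w
  precedes-trans u       (here b∈w) (here _)  = contradiction b∈w (Unique[x∷xs]⇒x∉xs u)
  precedes-trans u       (here b∈w) (there q) = here (precedes-∈ʳ q)
  precedes-trans u       (there p)  (here _)  = contradiction (precedes-∈ʳ p) (Unique[x∷xs]⇒x∉xs u)
  precedes-trans (_ ∷ u) (there p)  (there q) = there (precedes-trans u p q)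

  precedes-asym : ∀ {a b w} → Unique w → Precedes a b w → ¬ Precedes b a w
  precedes-asym u p q = precedes-irrefl u (precedes-trans u p q) refl

  precedes-total : ∀ {a b w} → a ∈ w → b ∈ w → a ≢ b → Precedes a b w ⊎ Precedes b a w
  precedes-total (here refl) (here refl) a≢b = contradiction refl a≢b
  precedes-total (here refl) (there b∈w) _   = inj₁ (here b∈w)
  precedes-total (there a∈w) (here refl) _   = inj₂ (here a∈w)
  precedes-total (there a∈w) (there b∈w) a≢b with precedes-total a∈w b∈w a≢b
  ... | inj₁ p = inj₁ (there p)
  ... | inj₂ p = inj₂ (there p)

  precedes-map : ∀ (f : Fin n → Fin n) {a b w} → Precedes a b w → Precedes (f a) (f b) (map f w)
  precedes-map f (here b∈w) = here (∈-map⁺ f b∈w)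
  precedes-map f (there p)  = there (precedes-map f p)

  earliest : ∀ {s S w} → s ∈ S → S ⊆ w → ∃[ f ] f ∈ S × (∀ {u} → u ∈ S → u ≢ f → Precedes f u w)
  earliest {w = []} s∈S S⊆w with S⊆w s∈S
  ... | ()
  earliest {S = S} {w = z ∷ w} s∈S S⊆w with _∈?_ _≟_ z S
  ... | yes z∈S = z , z∈S , λ u∈S u≢z → here (Any.tail u≢z (S⊆w u∈S))
  ... | no z∉S with earliest {w = w} s∈S (⊆∷∧∉⇒⊆ S⊆w z∉S)
  ...   | f , f∈S , first = f , f∈S , λ u∈S u≢f → there (first u∈S u≢f)

  memB⇒∈ : ∀ {b : Fin n} w → T (memB b w) → b ∈ w
  memB⇒∈ {b} (z ∷ w) p with z ≟ b
  ... | yes refl = here refl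
  ... | no _     = there (memB⇒∈ w p)

  ∈⇒memB : ∀ {b : Fin n} {w} → b ∈ w → T (memB b w)
  ∈⇒memB {b} {z ∷ w} b∈ with z ≟ b | b∈
  ... | yes _  | _           = _
  ... | no z≢b | here refl   = contradiction refl z≢b
  ... | no _   | there b∈w   = ∈⇒memB b∈w

  before⇒precedes : ∀ {a b} w → Before a b w → Precedes a b w
  before⇒precedes {a} {b} (z ∷ w) p with z ≟ a
  ... | yes refl = here (memB⇒∈ w p)
  ... | no _ with z ≟ b
  ...   | no _ = there (before⇒precedes w p)

  precedes⇒before : ∀ {a b w} → Unique w → Precedes a b w → Before a b w
  precedes⇒before {a} {b} {z ∷ w} u p with z ≟ a | p
  ... | yes _    | here b∈w = ∈⇒memB b∈w
  ... | yes refl | there q  = contradiction (precedes-∈ˡ q) (Unique[x∷xs]⇒x∉xs u)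
  ... | no z≢a   | here _   = contradiction refl z≢a
  ... | no _     | there q with z ≟ b | u
  ...   | yes refl | _     = contradiction (precedes-∈ʳ q) (Unique[x∷xs]⇒x∉xs u)
  ...   | no _     | _ ∷ u = precedes⇒before u q

  swapF-left : ∀ (a b : Fin n) → swapF a b a ≡ b
  swapF-left a b with a ≟ a
  ... | yes _  = refl
  ... | no a≢a = contradiction refl a≢a

  swapF-right : ∀ (a b : Fin n) → swapF a b b ≡ a
  swapF-right a b with b ≟ a
  ... | yes b≡a = b≡a
  ... | no _ with b ≟ b
  ...   | yes _  = refl
  ...   | no b≢b = contradiction refl b≢b

  swapF-other : ∀ {a b z : Fin n} → z ≢ a → z ≢ b → swapF a b z ≡ z
  swapF-other {a} {b} {z} z≢a z≢b with z ≟ a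
  ... | yes z≡a = contradiction z≡a z≢a
  ... | no _ with z ≟ b
  ...   | yes z≡b = contradiction z≡b z≢b
  ...   | no _    = refl

  swapF-cases : ∀ (a b z : Fin n) → (z ≡ a × swapF a b z ≡ b) ⊎ (z ≡ b × swapF a b z ≡ a) ⊎
                          (z ≢ a × z ≢ b × swapF a b z ≡ z)
  swapF-cases a b z with z ≟ a | z ≟ b
  ... | yes refl | _        = inj₁ (refl , refl)
  ... | no _     | yes refl = inj₂ (inj₁ (refl , refl))
  ... | no z≢a   | no z≢b   = inj₂ (inj₂ (z≢a , z≢b , refl))

  swapF-involutive : ∀ (a b z : Fin n) → swapF a b (swapF a b z) ≡ z
  swapF-involutive a b z with swapF-cases a b z
  ... | inj₁ (refl , e)        = trans (cong (swapF a b) e) (swapF-right a b)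
  ... | inj₂ (inj₁ (refl , e)) = trans (cong (swapF a b) e) (swapF-left a b)
  ... | inj₂ (inj₂ (_ , _ , e)) = trans (cong (swapF a b) e) e

  swapF-injective : ∀ (a b : Fin n) {y z} → swapF a b y ≡ swapF a b z → y ≡ z
  swapF-injective a b {y} {z} e =
    trans (≡.sym (swapF-involutive a b y)) (trans (cong (swapF a b) e) (swapF-involutive a b z))

  swapList-involutive : ∀ (a b : Fin n) w → swapList a b (swapList a b w) ≡ w
  swapList-involutive a b w =
    trans (≡.sym (map-∘ w)) (trans (map-cong (swapF-involutive a b) w) (map-id w))

  swapList-injective : ∀ (a b : Fin n) {v w} → swapList a b v ≡ swapList a b w → v ≡ w
  swapList-injective a b = map-injective (swapF-injective a b)

  precedes-swap : ∀ (a b : Fin n) {u v w} → Precedes u v (swapList a b w) →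
                  Precedes (swapF a b u) (swapF a b v) w
  precedes-swap a b {w = w} p =
    subst (Precedes _ _) (swapList-involutive a b w) (precedes-map (swapF a b) p)

-- Exchanges in elimination orderings

module _ {n : ℕ} (G : Graph n) where

  record Word (w : List (Fin n)) : Set where
    field
      uniq : Unique w
      all  : ∀ z → z ∈ w
      elim : ∀ {v a b} → Precedes v a w → Precedes v b w → a ≢ b →
             Adj G v a → Adj G v b → Adj G a b
  open Word

  elimination⇒word : ∀ {w} → IsElimOrdering G w → Word w
  elimination⇒word {w} (p , e) = record
    { uniq = u
    ; all  = λ z → ∈-resp-↭ (↭-sym p) (∈-allFin z)
    ; elim = λ pa pb → e _ _ _ (precedes⇒before u pa) (precedes⇒before u pb) }
    where
    u : Unique w
    u = Unique-resp-↭ (≡.setoid (Fin n)) (↭⇒↭ₛ (↭-sym p)) (Unique.allFin⁺ n)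

  word⇒elimination : ∀ {w} → Word w → IsElimOrdering G w
  word⇒elimination {w} W =
    ∼bag⇒↭ (unique∧set⇒bag (uniq W) (Unique.allFin⁺ n)
             (mk⇔ (λ _ → ∈-allFin _) (λ _ → all W _))) ,
    λ _ _ _ pa pb → elim W (before⇒precedes w pa) (before⇒precedes w pb)

  -- After the exchange `x` is harmless, being simplicial in the whole graph, and whatever follows
  -- `y` followed it before. Another vertex gains a later vertex only if it lies between `y` and
  -- `x`; it then gains `y` and loses `x`, the case left to the last premise.
  swap-word : ∀ {x y w} → Word w → (∀ {a b} → a ≢ b → Adj G x a → Adj G x b → Adj G a b) →
              Precedes y x w →
              (∀ {v b} → Precedes y v w → Precedes v x w → Precedes v b w →
                 Adj G y v → Adj G v b → b ≢ x → b ≢ y → Adj G y b) →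
              Word (swapList x y w)
  swap-word {x} {y} {w} W simp y<x between = record
    { uniq = Unique.map⁺ (swapF-injective x y) (uniq W)
    ; all  = λ z → subst (_∈ _) (swapF-involutive x y z) (∈-map⁺ σ (all W (σ z)))
    ; elim = λ pa pb → go (swapF-cases x y _) (precedes-swap x y pa) (precedes-swap x y pb) }
    where
    σ : Fin n → Fin n
    σ = swapF x y

    after-x : ∀ {a} → Adj G y a → Precedes x (σ a) w → Precedes y a w
    after-x {a} ya p with swapF-cases x y a
    ... | inj₁ (refl , e) =
          contradiction (subst (λ z → Precedes x z w) e p) (precedes-asym (uniq W) y<x)
    ... | inj₂ (inj₁ (refl , e)) = contradiction refl (Adj⇒≢ G ya)
    ... | inj₂ (inj₂ (_ , _ , e)) =
          precedes-trans (uniq W) y<x (subst (λ z → Precedes x z w) e p)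

    -- In the swapped word `x` stands where `y` stood, hence the extra clause for `a ≡ x`. The
    -- second alternative is the newly gained `y`.
    after-other : ∀ {v a} → v ≢ y → Precedes v (σ a) w →
                  (Precedes v a w × (a ≡ x → Precedes v y w)) ⊎
                  (a ≡ y × Precedes y v w × Precedes v x w)
    after-other {v} {a} v≢y p with swapF-cases x y a
    ... | inj₁ (refl , e) = let v<y = subst (λ z → Precedes v z w) e p in
          inj₁ (precedes-trans (uniq W) v<y y<x , λ _ → v<y)
    ... | inj₂ (inj₂ (a≢x , _ , e)) =
          inj₁ (subst (λ z → Precedes v z w) e p , λ a≡x → contradiction a≡x a≢x)
    ... | inj₂ (inj₁ (refl , e)) with precedes-total (all W v) (all W y) v≢y
    ...   | inj₁ v<y = inj₁ (v<y , λ _ → v<y)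
    ...   | inj₂ y<v = inj₂ (refl , y<v , subst (λ z → Precedes v z w) e p)

    to-y : ∀ {v b} → Precedes y v w → Precedes v x w → y ≢ b → Adj G v y → Adj G v b →
           Precedes v b w × (b ≡ x → Precedes v y w) → Adj G y b
    to-y y<v v<x y≢b vy vb (v<b , b≡x⇒) = between y<v v<x v<b (Adj-sym G vy) vb
      (λ b≡x → precedes-asym (uniq W) y<v (b≡x⇒ b≡x)) (≢-sym y≢b)

    go : ∀ {v a b} →
         (v ≡ x × σ v ≡ y) ⊎ (v ≡ y × σ v ≡ x) ⊎ (v ≢ x × v ≢ y × σ v ≡ v) →
         Precedes (σ v) (σ a) w → Precedes (σ v) (σ b) w → a ≢ b →
         Adj G v a → Adj G v b → Adj G a b
    go (inj₁ (refl , _)) _ _ a≢b va vb = simp a≢b va vb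
    go {a = a} {b} (inj₂ (inj₁ (refl , e))) pa pb a≢b va vb =
      elim W (after-x va (subst (λ z → Precedes z (σ a) w) e pa))
             (after-x vb (subst (λ z → Precedes z (σ b) w) e pb)) a≢b va vb
    go {a = a} {b} (inj₂ (inj₂ (_ , v≢y , e))) pa pb a≢b va vb
      with after-other v≢y (subst (λ z → Precedes z (σ a) w) e pa)
         | after-other v≢y (subst (λ z → Precedes z (σ b) w) e pb)
    ... | inj₁ (v<a , _)           | inj₁ (v<b , _) = elim W v<a v<b a≢b va vb
    ... | inj₂ (refl , y<v , v<x) | inj₁ b         = to-y y<v v<x a≢b va vb b
    ... | inj₁ a                   | inj₂ (refl , y<v , v<x) =
          Adj-sym G (to-y y<v v<x (≢-sym a≢b) vb va a)
    ... | inj₂ (refl , _)          | inj₂ (refl , _) = contradiction refl a≢b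

  module _ {k : ℕ} {x y : Fin n} {S : List (Fin n)} (E : Ends G {k} x y S) where
    open Ends E

    -- All neighbours in `S` of the earliest vertex of `S` come later, so that vertex is simplicial
    -- in `S`.
    first-end : ∀ {w} → Word w → (∀ {u} → u ∈ S → u ≢ x → Precedes x u w) ⊎
                                 (∀ {u} → u ∈ S → u ≢ y → Precedes y u w)
    first-end W with earliest x∈S (λ {u} _ → all W u)
    ... | f , f∈S , first with only f∈S (λ a b a≢b fa fb →
                elim W (first a (≢-sym (Adj⇒≢ G fa))) (first b (≢-sym (Adj⇒≢ G fb))) a≢b fa fb)
    ...   | inj₁ refl = inj₁ first
    ...   | inj₂ refl = inj₂ first

    y-first : ∀ {w u} → Word w → u ∈ S → u ≢ x → Precedes u x w →
              ∀ {u} → u ∈ S → u ≢ y → Precedes y u w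
    y-first W u∈S u≢x u<x with first-end W
    ... | inj₁ x-first = contradiction u<x (precedes-asym (uniq W) (x-first u∈S u≢x))
    ... | inj₂ first   = first

    -- As `y` comes first in `S`, its `k` neighbours in `S` are later than `y`. With `v` they form a
    -- clique, so `v` is one of them.
    later-nbrs-of-y : ∀ {w R v} → KTree G k R → (∀ z → z ∈ R) → Word w →
                      Precedes y x w → Precedes y v w → Adj G y v → v ∈ S
    later-nbrs-of-y {w} {R} {v} t all∈R W y<x y<v yv with min-degree G ktree y∈S
    ... | Q , N = Nbrs.within N (nbrs-complete G t (all∈R y) (Nbrs-⊆ G (λ {u} _ → all∈R u) N)
                    (all∈R v) yv (λ a b a≢b → elim W (y< a) (y< b) a≢b (y~ a) (y~ b)))
      where
      y~ : ∀ {a} → a ∈ v ∷ Q → Adj G y a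
      y~ (here refl) = yv
      y~ (there q)   = Nbrs.adj-to N q
      y< : ∀ {a} → a ∈ v ∷ Q → Precedes y a w
      y< (here refl) = y<v
      y< (there q)   = y-first W y∈S (≢-sym x≢y) y<x (Nbrs.within N q)
                         (≢-sym (Adj⇒≢ G (Nbrs.adj-to N q)))

  module _ {k : ℕ} {R : List (Fin n)} (t : KTree G k R) (all∈R : ∀ z → z ∈ R)
           {x : Fin n} (sxR : Simplicial G R x) where

    -- A neighbour `v` of `y` between `y` and `x` would lie in `S′`. Then `x` would not be first in
    -- `S′`, so `y′` would be, and `y′` would precede `x`.
    swap-inner : ∀ {y y′ S S′ w} → Ends G {k} x y S → Deletion y S S′ → Ends G {k} x y′ S′ →
                 Word w → Precedes y x w → ¬ Precedes y′ x w → Word (swapList x y w)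
    swap-inner E d E′ W y<x y′≮x = swap-word W (sxR (all∈R _) (all∈R _)) y<x
      λ y<v v<x _ yv _ _ _ → contradiction
        (y-first E′ W
          (keep d (later-nbrs-of-y E t all∈R W y<x y<v yv) (≢-sym (Adj⇒≢ G yv)))
          (precedes-irrefl (uniq W) v<x) v<x (Ends.x∈S E′) (Ends.x≢y E′))
        y′≮x

    -- x and y have the same neighbours once the vertices before y are removed.
    swap-last : ∀ {y S S′ w} → Ends G {k} x y S → Deletion y S S′ → length S′ ≡ suc k →
                Clique G S′ → Unique S′ → Word w → Precedes y x w → Word (swapList x y w)
    swap-last E d l c uS′ W y<x with last-twins G E l c uS′ d
    ... | Q , N , S⊆Q , y~ = swap-word W (sxR (all∈R _) (all∈R _)) y<x
      λ y<v v<x v<b yv vb b≢x b≢y →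
        -- `v` lies in `S`, hence in `Q`, and is adjacent to `x`. Both `x` and `b` come after `v`,
        -- so they are adjacent; then `b` is in `Q` because `x` is simplicial.
        let xv = Nbrs.adj-to N (S⊆Q (later-nbrs-of-y E t all∈R W y<x y<v yv)
                   (precedes-irrefl (uniq W) v<x) (≢-sym (Adj⇒≢ G yv)))
            xb = elim W v<x v<b (≢-sym b≢x) (Adj-sym G xv) vb
        in y~ (simplicial-nbrs G t (all∈R x) sxR (Nbrs-⊆ G (λ {u} _ → all∈R u) N) (all∈R _) xb)

-- Counting words and comparing with thirds

T-not⁺ : ∀ {b} → ¬ T b → T (not b)
T-not⁺ {false} _ = _
T-not⁺ {true} ¬b = ¬b _

T-not⁻ : ∀ {b} → T (not b) → ¬ T b
T-not⁻ {false} _ ()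

module _ {A : Set} where

  _without_ : (A → Bool) → (A → Bool) → A → Bool
  (p without q) w = p w ∧ not (q w)

  without⁺ : ∀ (p q : A → Bool) w → T (p w) → ¬ T (q w) → T ((p without q) w)
  without⁺ p q w pw ¬qw = Equivalence.from T-∧ (pw , T-not⁺ ¬qw)

  without⁻ : ∀ (p q : A → Bool) {w} → T ((p without q) w) → T (p w) × ¬ T (q w)
  without⁻ p q pq = let pw , ¬qw = Equivalence.to T-∧ pq in pw , T-not⁻ ¬qw

  countB-injection : ∀ {Ω} (p q : A → Bool) (f : A → A) → Unique Ω →
                     (∀ {v w} → f v ≡ f w → v ≡ w) →
                     (∀ {w} → w ∈ Ω → T (p w) → f w ∈ Ω × T (q (f w))) → countB p Ω ≤ countB q Ω
  countB-injection {Ω} p q f uΩ inj into =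
    subst₂ _≤_ (trans (length-map f (filterᵇ p Ω)) (≡.sym (countB-filter p Ω)))
               (≡.sym (countB-filter q Ω))
      (⊆-length (Unique.map⁺ inj (Unique.filter⁺ (T? ∘ p) uΩ)) (Unique.filter⁺ (T? ∘ q) uΩ) sub′)
    where
    sub′ : map f (filterᵇ p Ω) ⊆ filterᵇ q Ω
    sub′ v∈ with ∈-map⁻ f v∈
    ... | w , w∈ , refl = let w∈Ω , pw = ∈-filter⁻ (T? ∘ p) {xs = Ω} w∈
                              fw∈Ω , qw = into w∈Ω pw
                          in ∈-filter⁺ (T? ∘ q) fw∈Ω qw

  countB-mono : ∀ {Ω} (p q : A → Bool) → Unique Ω →
                (∀ {w} → w ∈ Ω → T (p w) → T (q w)) → countB p Ω ≤ countB q Ω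
  countB-mono p q uΩ p⇒q = countB-injection p q (λ w → w) uΩ (λ e → e) (λ w∈Ω pw → w∈Ω , p⇒q w∈Ω pw)

  countB-without : ∀ Ω (p q : A → Bool) → (∀ {w} → w ∈ Ω → T (q w) → T (p w)) →
                   countB p Ω ≡ countB q Ω + countB (p without q) Ω
  countB-without []      p q _ = refl
  countB-without (w ∷ Ω) p q q⇒p with p w | q w | q⇒p (here refl)
                                    | countB-without Ω p q (q⇒p ∘ there)
  ... | true  | true  | _ | ih = cong suc ih
  ... | true  | false | _ | ih = trans (cong suc ih) (≡.sym (+-suc _ _))
  ... | false | false | _ | ih = ih
  ... | false | true  | h | _  = ⊥-elim (h _)

  countB-complement : ∀ Ω (p q : A → Bool) → (∀ {w} → w ∈ Ω → T (p w) ⊎ T (q w)) →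
                      (∀ {w} → w ∈ Ω → T (p w) → ¬ T (q w)) → countB p Ω + countB q Ω ≡ length Ω
  countB-complement []      p q _ _ = refl
  countB-complement (w ∷ Ω) p q t e with p w | q w | t (here refl) | e (here refl)
                                       | countB-complement Ω p q (t ∘ there) (e ∘ there)
  ... | true  | true  | _ | h | _  = ⊥-elim (h _ _)
  ... | true  | false | _ | _ | ih = cong suc ih
  ... | false | true  | _ | _ | ih = trans (+-suc _ _) (cong suc ih)
  ... | false | false | inj₁ () | _ | _
  ... | false | false | inj₂ () | _ | _

-- For the descent along a ladder: a step of less than one third from above two thirds ends above
-- one third.
3*>2*⇒< : ∀ {c} d e {N} → c ≡ d + e → 2 * N < 3 * c → 3 * e < N → N < 3 * d
3*>2*⇒< d e {N} refl 2N<3c 3e<N = +-cancelʳ-< N N (3 * d) (begin-strict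
  N + N         ≡⟨ cong (N +_) (≡.sym (+-identityʳ N)) ⟩
  2 * N         <⟨ 2N<3c ⟩
  3 * (d + e)   ≡⟨ *-distribˡ-+ 3 d e ⟩
  3 * d + 3 * e ≤⟨ +-monoʳ-≤ (3 * d) (<⇒≤ 3e<N) ⟩
  3 * d + N     ∎)
  where open ≤-Reasoning

3*>2*⇒3*< : ∀ c d {N} → c + d ≡ N → 2 * N < 3 * c → 3 * d < N
3*>2*⇒3*< c d refl 2N<3c = +-cancelˡ-< (2 * (c + d)) (3 * d) (c + d) (begin-strict
  2 * (c + d) + 3 * d <⟨ +-monoˡ-< (3 * d) 2N<3c ⟩
  3 * c + 3 * d       ≡⟨ ≡.sym (*-distribˡ-+ 3 c d) ⟩
  3 * (c + d)         ≡⟨ +-comm (c + d) (2 * (c + d)) ⟩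
  2 * (c + d) + (c + d) ∎)
  where open ≤-Reasoning

3*<⇒3*>2* : ∀ c d {N} → c + d ≡ N → 3 * d < N → 2 * N < 3 * c
3*<⇒3*>2* c d refl 3d<N = +-cancelʳ-< (3 * d) (2 * (c + d)) (3 * c) (begin-strict
  2 * (c + d) + 3 * d   <⟨ +-monoʳ-< (2 * (c + d)) 3d<N ⟩
  2 * (c + d) + (c + d) ≡⟨ +-comm (2 * (c + d)) (c + d) ⟩
  3 * (c + d)           ≡⟨ *-distribˡ-+ 3 c d ⟩
  3 * c + 3 * d         ∎)
  where open ≤-Reasoning

-- Ladders with the prefix property, and balance

module _ {n : ℕ} (Ω : List (List (Fin n))) where

  module _ (x : Fin n) where

    -- The value at `[]` means that nothing follows the last rung, so the side condition of `Swaps`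
    -- holds there automatically.
    head-before : List (Fin n) → List (Fin n) → Bool
    head-before []      w = false
    head-before (y ∷ _) w = before y x w

    Swaps : Fin n → List (Fin n) → Set
    Swaps y Y = ∀ {w} → w ∈ Ω → Before y x w → ¬ T (head-before Y w) → swapList x y w ∈ Ω

    -- A ladder (x , y ∷ Y) in which the elements of y ∷ Y earlier than x always form a prefix of it.
    data Rungs : Fin n → List (Fin n) → Set where
      last : ∀ {y} → y ≢ x → Swaps y [] → Rungs y []
      more : ∀ {y y′ Y} → y ≢ x → Swaps y (y′ ∷ Y) →
             (∀ {w} → w ∈ Ω → Before y′ x w → Before y y′ w) →
             y ∉ y′ ∷ Y → Rungs y′ Y → Rungs y (y′ ∷ Y)

  module _ {x : Fin n} (word-unique : ∀ {w} → w ∈ Ω → Unique w) where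

    before-trans : ∀ {a b c w} → w ∈ Ω → Before a b w → Before b c w → Before a c w
    before-trans {w = w} w∈Ω p q = precedes⇒before (word-unique w∈Ω)
      (precedes-trans (word-unique w∈Ω) (before⇒precedes w p) (before⇒precedes w q))

    rungs-head : ∀ {y Y} → Rungs x y Y → y ≢ x
    rungs-head (last y≢x _)       = y≢x
    rungs-head (more y≢x _ _ _ _) = y≢x

    rungs-swaps : ∀ {y Y} → Rungs x y Y → Swaps x y Y
    rungs-swaps (last _ s)       = s
    rungs-swaps (more _ s _ _ _) = s

    rungs-unique : ∀ {y Y} → Rungs x y Y → Unique (y ∷ Y)
    rungs-unique (last _ _)         = [] ∷ []
    rungs-unique (more _ _ _ y∉ r) = ∷-unique y∉ (rungs-unique r)

    rungs-x∉ : ∀ {y Y} → Rungs x y Y → x ∉ y ∷ Y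
    rungs-x∉ r                  (here x≡y) = rungs-head r (≡.sym x≡y)
    rungs-x∉ (more _ _ _ _ r) (there x∈) = rungs-x∉ r x∈

    -- By induction `y′` precedes `z`, hence also `x`; therefore `y` precedes `y′`.
    head-precedes : ∀ {y Y z w} → Rungs x y Y → w ∈ Ω → z ∈ Y → Before z x w → Before y z w
    head-precedes (more _ _ o _ _) w∈Ω (here refl) z<x = o w∈Ω z<x
    head-precedes (more _ _ o _ r) w∈Ω (there z∈Y) z<x =
      let y′<z = head-precedes r w∈Ω z∈Y z<x
      in before-trans w∈Ω (o w∈Ω (before-trans w∈Ω y′<z z<x)) y′<z

    rungs⇒ladder : ∀ {y Y} → Rungs x y Y → Ladder Ω x (y ∷ Y)
    rungs⇒ladder r = (λ ()) , rungs-unique r , rungs-x∉ r , ordered r , swappable r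
      where
      ordered : ∀ {y Y} → Rungs x y Y → ∀ w → w ∈ Ω → ∀ (i j : Fin (length (y ∷ Y))) → i Fin.< j →
                Before (lookup (y ∷ Y) i) x w → Before (lookup (y ∷ Y) j) x w →
                Before (lookup (y ∷ Y) i) (lookup (y ∷ Y) j) w
      ordered {Y = Y} r w w∈Ω zero (suc j) _ _ z<x = head-precedes r w∈Ω (∈-lookup {xs = Y} j) z<x
      ordered (more _ _ _ _ r) w w∈Ω (suc i) (suc j) (s≤s i<j) = ordered r w w∈Ω i j i<j
      swappable : ∀ {y Y} → Rungs x y Y → ∀ w → w ∈ Ω → ∀ (i : Fin (length (y ∷ Y))) →
                  Before (lookup (y ∷ Y) i) x w →
                  (∀ (j : Fin (length (y ∷ Y))) → i Fin.< j → ¬ Before (lookup (y ∷ Y) j) x w) →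
                  swapList x (lookup (y ∷ Y) i) w ∈ Ω
      swappable (last _ s) w w∈Ω zero y<x _ = s w∈Ω y<x (λ ())
      -- Maximality of the index is used only for the next rung.
      swappable (more _ s _ _ _) w w∈Ω zero y<x h = s w∈Ω y<x (h (suc zero) (s≤s z≤n))
      swappable (more _ _ _ _ r) w w∈Ω (suc i) y<x h =
        swappable r w w∈Ω i y<x (λ j i<j → h (suc j) (s≤s i<j))

    module _ (uΩ : Unique Ω) where

      -- The words in which y is the last element of the ladder before x.
      topped-by : Fin n → List (Fin n) → List (Fin n) → Bool
      topped-by y Y = before y x without head-before x Y

      -- Exchanging `x` and `y` is injective. The predicate `q` describes the images: `x` before `y`
      -- at the first rung, and topped by the previous rung at every later one.
      topped-by-shrinks : ∀ {y Y} (q : List (Fin n) → Bool) → Rungs x y Y →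
        (∀ {w} → w ∈ Ω → Before y x w → swapList x y w ∈ Ω → T (q (swapList x y w))) →
        countB (topped-by y Y) Ω ≤ countB q Ω
      topped-by-shrinks {y} {Y} q r into =
        countB-injection (topped-by y Y) q (swapList x y) uΩ (swapList-injective x y)
          (λ w∈Ω top → let y<x , ¬next = without⁻ (before y x) (head-before x Y) top
                           w′∈Ω = rungs-swaps r w∈Ω y<x ¬next
                       in w′∈Ω , into w∈Ω y<x w′∈Ω)

      swapped-apart : ∀ {y w} → w ∈ Ω → Before y x w → ¬ Before y x (swapList x y w)
      swapped-apart {y} {w} w∈Ω y<x p = precedes-asym (word-unique w∈Ω) (before⇒precedes w y<x)
        (subst₂ (λ a b → Precedes a b w) (swapF-right x y) (swapF-left x y)
          (precedes-swap x y {w = w} (before⇒precedes _ p)))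

      -- Descends while Pr[y < x] exceeds 2/3, keeping the fraction of words topped by `y` below
      -- 1/3. That fraction is the drop to the next rung, so the next probability exceeds 1/3.
      find-balanced : ∀ {y Y} → Rungs x y Y → 2 * length Ω < 3 * countB (before y x) Ω →
                      3 * countB (topped-by y Y) Ω < length Ω → ∃[ z ] BalancedPair Ω z x
      -- At the last rung every word with `y` before `x` is topped by `y`, so one fraction would be
      -- above 2/3 and below 1/3.
      find-balanced {y} (last _ _) c>2/3 e<1/3 = contradiction
        (<-≤-trans c>2/3 (≤-trans (*-monoʳ-≤ 3 (countB-mono (before y x) (topped-by y []) uΩ
          (λ {w} _ p → without⁺ (before y x) (head-before x []) w p (λ ()))))
          (≤-trans (<⇒≤ e<1/3) (m≤m+n _ _))))
        (<-irrefl refl)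
      find-balanced {y} (more {y′ = y′} {Y} y≢x _ o y∉ r) c>2/3 e<1/3
        with 3 * countB (before y′ x) Ω ≤? 2 * length Ω
           | 3*>2*⇒< (countB (before y′ x) Ω) (countB (topped-by y (y′ ∷ Y)) Ω)
             (countB-without Ω (before y x) (before y′ x)
               (λ w∈Ω p → before-trans w∈Ω (o w∈Ω p) p)) c>2/3 e<1/3
      ... | yes ≤2/3 | 1/3< = y′ , rungs-head r , <⇒≤ 1/3< , ≤2/3
      ... | no ≰2/3  | _    = find-balanced r (≰⇒> ≰2/3)
        -- In a word topped by `y′`, the exchange leaves `y` in place, moves `x` to the position of
        -- `y′` behind it, and puts `y′` after `x`: the result is topped by `y`.
        (≤-<-trans (*-monoʳ-≤ 3 (topped-by-shrinks (topped-by y (y′ ∷ Y)) r (λ {w} w∈Ω y′<x w′∈Ω →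
          without⁺ (before y x) (before y′ x) (swapList x y′ w)
            (precedes⇒before (word-unique w′∈Ω)
              (subst₂ (λ a b → Precedes a b (swapList x y′ w))
                (swapF-other y≢x (y∉ ∘ here)) (swapF-right x y′)
                (precedes-map (swapF x y′) (before⇒precedes w (o w∈Ω y′<x)))))
            (swapped-apart w∈Ω y′<x)))) e<1/3)

  module _ (word-unique : ∀ {w} → w ∈ Ω → Unique w) (word-all : ∀ {w} → w ∈ Ω → ∀ z → z ∈ w)
           (uΩ : Unique Ω) where

    before-complement : ∀ {x y} → x ≢ y →
                        countB (before x y) Ω + countB (before y x) Ω ≡ length Ω
    before-complement {x} {y} x≢y = countB-complement Ω (before x y) (before y x)
      (λ w∈Ω → Sum.map (precedes⇒before (word-unique w∈Ω)) (precedes⇒before (word-unique w∈Ω))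
        (precedes-total (word-all w∈Ω x) (word-all w∈Ω y) x≢y))
      (λ {w} w∈Ω p q → precedes-asym (word-unique w∈Ω) (before⇒precedes w p) (before⇒precedes w q))

    -- The words topped by the first rung inject into those with `x` before `y`, which are less than
    -- a third of all words.
    rungs-balanced : ∀ {x y Y} → Rungs x y Y → 2 * length Ω < 3 * countB (before y x) Ω →
                     ∃[ z ] BalancedPair Ω z x
    rungs-balanced {x} {y} {Y} r c>2/3 = find-balanced word-unique uΩ r c>2/3
      (≤-<-trans (*-monoʳ-≤ 3 (topped-by-shrinks word-unique uΩ (before x y) r
        (λ {w} w∈Ω y<x w′∈Ω → precedes⇒before (word-unique w′∈Ω)
          (subst₂ (λ a b → Precedes a b (swapList x y w)) (swapF-right x y) (swapF-left x y)
            (precedes-map (swapF x y) (before⇒precedes w y<x))))))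
        (3*>2*⇒3*< (countB (before y x) Ω) (countB (before x y) Ω)
          (before-complement (rungs-head word-unique r)) c>2/3))

    -- If neither order of `x` and `y` is balanced, one of them has probability above 2/3, and the
    -- ladder starting from the likelier first element is descended.
    double-rungs : ∀ {x y X Y} → Rungs x y Y → Rungs y x X → DoubleLadder Ω × Balanced Ω
    double-rungs {x} {y} {X} {Y} r s =
      (_ , _ , x , X , y , Y , refl , refl ,
       rungs⇒ladder word-unique r , rungs⇒ladder word-unique s) ,
      inj₁ balanced
      where
      balanced : ∃[ a ] ∃[ b ] BalancedPair Ω a b
      balanced with 3 * countB (before y x) Ω ≤? 2 * length Ω
                  | length Ω ≤? 3 * countB (before y x) Ω
      ... | yes ≤2/3 | yes 1/3≤ = y , x , rungs-head word-unique r , 1/3≤ , ≤2/3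
      ... | no ≰2/3  | _        = let z , b = rungs-balanced r (≰⇒> ≰2/3) in z , x , b
      ... | yes _    | no 1/3≰  = let z , b = rungs-balanced s x<y>2/3 in z , y , b
        where
        x<y>2/3 : 2 * length Ω < 3 * countB (before x y) Ω
        x<y>2/3 = 3*<⇒3*>2* (countB (before x y) Ω) (countB (before y x) Ω)
                    (before-complement (rungs-head word-unique s)) (≰⇒> 1/3≰)

-- Ladders in the elimination orderings of a k-tree

module _ {n : ℕ} {G : Graph n} {Ω : List (List (Fin n))}
         (into : ∀ {w} → Word G w → w ∈ Ω) (from : ∀ {w} → w ∈ Ω → Word G w) where

  swaps-intro : ∀ {x y} Y → (∀ {w} → Word G w → Precedes y x w → ¬ T (head-before Ω x Y w) →
                  Word G (swapList x y w)) → Swaps Ω x y Y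
  swaps-intro Y f {w} w∈Ω y<x ¬next = into (f (from w∈Ω) (before⇒precedes w y<x) ¬next)

  -- The bound `m` drives the recursion. The inclusion in `S` is carried along to show that a
  -- deleted `y` does not recur among the later rungs.
  ends-rungs : ∀ {k R x y S} → KTree G k R → (∀ z → z ∈ R) → Simplicial G R x →
               ∀ m → length S ≤ m → Ends G {k} x y S → ∃[ Y ] Rungs Ω x y Y × y ∷ Y ⊆ S
  ends-rungs {S = []} _ _ _ zero z≤n E with Ends.y∈S E
  ... | ()
  ends-rungs {x = x} {y} {S} t all∈R sx′ (suc m) l E
    with delete-simplicial G (Ends.ktree E)
           (λ c → Ends.x≁y E (c (Ends.x∈S E) (Ends.y∈S E) (Ends.x≢y E))) (Ends.y∈S E) (Ends.sy E)
  ... | S′ , t′ , d = go (clique-or-not G t′)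
    where
    open Ends E
    go : _ → ∃[ Y ] Rungs Ω x y Y × y ∷ Y ⊆ S
    go (inj₁ (l′ , c)) = [] ,
      last (≢-sym x≢y) (swaps-intro [] (λ W y<x _ →
        swap-last G t all∈R sx′ E d l′ (λ {a} {b} → c {a} {b}) (KTree-unique G t′) W y<x)) ,
      ∈-∷⁺ʳ y∈S (λ ())
    go (inj₂ ¬c) with next-end G E t′ ¬c d
    ... | y′ , E′ with ends-rungs t all∈R sx′ m (s≤s⁻¹ (subst (_≤ suc m) (len d) l)) E′
    ...   | Y , r , Y⊆S′ = y′ ∷ Y ,
      more (≢-sym x≢y)
        (swaps-intro (y′ ∷ Y) (λ W y<x ¬next → swap-inner G t all∈R sx′ E d E′ W y<x
          (λ p → ¬next (precedes⇒before (Word.uniq W) p))))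
        (λ {w} w∈Ω p → let W = from w∈Ω in precedes⇒before (Word.uniq W)
          (y-first G E W (sub d (Ends.y∈S E′)) (≢-sym (Ends.x≢y E′)) (before⇒precedes w p)
            (sub d (Ends.y∈S E′)) (∉⇒≢ (gone d) (Ends.y∈S E′))))
        (gone d ∘ Y⊆S′) r ,
      ∈-∷⁺ʳ y∈S (sub d ∘ Y⊆S′)

  simplicial-rungs : ∀ {k R x y} → KTree G k R → (∀ z → z ∈ R) → Simplicial G R x → Simplicial G R y →
                     x ≢ y → ¬ Adj G x y → ∃ (Rungs Ω x y)
  simplicial-rungs t all∈R sx sy x≢y x≁y
    with shrink-to-ends G _ ≤-refl t (all∈R _) (all∈R _) x≢y x≁y sx sy
  ... | S , E with ends-rungs t all∈R sx _ ≤-refl E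
  ...   | Y , r , _ = Y , r

  -- In a complete graph every exchange is allowed, so a single rung suffices.
  clique-rungs : ∀ {x y} → (∀ {a b} → a ≢ b → Adj G a b) → y ≢ x → Rungs Ω x y []
  clique-rungs c y≢x = last y≢x (swaps-intro [] (λ W y<x _ →
    swap-word G W (λ a≢b _ _ → c a≢b) y<x (λ _ _ _ _ _ _ b≢y → c (≢-sym b≢y))))

  ktree-rungs : ∀ {k R} → 1 ≤ k → KTree G k R → (∀ z → z ∈ R) →
                ∃[ x ] ∃[ y ] ∃ (Rungs Ω x y) × ∃ (Rungs Ω y x)
  ktree-rungs {k} {R} 1≤k t all∈R = go (clique-or-not G t)
    where
    two-vertices : Σ (Fin n) λ x → Σ (Fin n) λ y → x ≢ y
    -- A k-tree has at least `k + 1` vertices, which is at least two since `1 ≤ k`.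
    two-vertices = two-distinct (KTree-unique G t) (≤-trans (s≤s 1≤k) (min-size G t))
    go : (length R ≡ suc k × Clique G R) ⊎ ¬ Clique G R →
         ∃[ x ] ∃[ y ] ∃ (Rungs Ω x y) × ∃ (Rungs Ω y x)
    go (inj₁ (_ , c)) with two-vertices
    ... | x , y , x≢y = x , y ,
      (_ , clique-rungs complete (≢-sym x≢y)) , (_ , clique-rungs complete x≢y)
      where
      complete : ∀ {a b} → a ≢ b → Adj G a b
      complete = c (all∈R _) (all∈R _)
    -- The vertex to be avoided is arbitrary in the first call; the second call avoids `x`.
    go (inj₂ ¬c) with another-simplicial G t ¬c (proj₁ two-vertices)
    ... | x , _ , sx , _ with another-simplicial G t ¬c x
    ...   | y , _ , sy , y≢x = x , y ,
      simplicial-rungs t all∈R sx sy (≢-sym y≢x) x≁y ,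
      simplicial-rungs t all∈R sy sx y≢x (x≁y ∘ Adj-sym G)
      where
      x≁y : ¬ Adj G x y
      x≁y = simplicial-nonadjacent G t ¬c (all∈R x) (all∈R y) sx sy

theorem6 : (k n : ℕ) → 1 ≤ k → (G : Graph n) → IsKTree k G →
    (Ω : List (List (Fin n))) → Unique Ω →
    (∀ w → (w ∈ Ω) ⇔ IsElimOrdering G w) →
    DoubleLadder Ω × Balanced Ω
theorem6 k n 1≤k G isKTree Ω uΩ iff =
  let R , t , all∈R = IsKTree⇒KTree isKTree
      x , y , (Y , r) , (X , s) = ktree-rungs into from 1≤k t all∈R
  in double-rungs Ω (Word.uniq ∘ from) (Word.all ∘ from) uΩ r s
  where
  into : ∀ {w} → Word G w → w ∈ Ω
  into W = Equivalence.from (iff _) (word⇒elimination G W)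
  from : ∀ {w} → w ∈ Ω → Word G w
  from w∈Ω = elimination⇒word G (Equivalence.to (iff _) w∈Ω)
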